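{- Let $q,\alpha_2\in\mathbb{Q}$ with $q\notin[0,5]$ and $\alpha_2\in(-2,0)$. Given a positive constant $\rho$ which is sufficiently small with respect to $q$ and $\alpha_2$, there is a planar graph $\Upsilon$ (depending on $\rho$) and a weight function $\widehat w:E(\Upsilon)\to\{\alpha_2\}$ that implements a weight $\beta$ such that $|1+\beta|\le\rho$. The size of $\Upsilon$ is at most a polynomial in $\log(\rho^{ -1})$.
   Context: Graphs are finite and may have loops and multiple edges. The number $q$ is fixed. A planar graph $\Upsilon$ with distinct distinguished vertices $s,t$ on the outer face and weights $\widehat w:E(\Upsilon)\to\mathbb{Q}$ implements the weight $w^*$ if $Z_{s|t}(\Upsilon)\ne0$ and $w^*=qZ_{st}(\Upsilon)/Z_{s|t}(\Upsilon)$. Here $Z_{st}(\Upsilon)$ (resp. $Z_{s|t}(\Upsilon)$) is the sum of $\big(\prod_{e\in A}\widehat w(e)\big)q^{\kappa(V(\Upsilon),A)}$ over all $A\subseteq E(\Upsilon)$ such that $s,t$ are in the same component (resp. different components) of $(V(\Upsilon),A)$, and $\kappa(V(\Upsilon),A)$ is the number of connected components of $(V(\Upsilon),A)$. The size bound means that the polynomial may depend on $q,\alpha_2$ but not on $\rho$. -}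

module Defs where

open import Algebra.Definitions.RawSemiring using (_^_)
open import Data.Bool.Base using (Bool; true; false; not)
open import Data.Fin.Base using (Fin)
import Data.Fin.Properties as Fin
open import Data.Fin.Subset using (Subset; inside; outside; _∈_; ⊤)
open import Data.Fin.Subset.Properties using (_∈?_)
import Data.Integer.Base as ℤ
open import Data.List.Base using (List; []; _∷_; [_]; _++_; map; foldr; filter; length; allFin; deduplicate; cartesianProduct)
import Data.List.Membership.Propositional as List
open import Data.List.Membership.Propositional.Properties using (∈-filter⁺; ∈-filter⁻; ∈-cartesianProduct⁺; ∈-allFin)
open import Data.List.Relation.Unary.Any using (here; there)
open import Data.Nat.Base using (ℕ; zero; suc; _+_; _*_)
open import Data.Nat.GeneralisedArithmetic using (iterate)
open import Data.Nat.Logarithm using (⌊log₂_⌋)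
open import Data.Product.Base using (Σ; ∃; _×_; _,_; proj₁; proj₂)
open import Data.Rational.Base as ℚ using (ℚ; 0ℚ; 1ℚ)
open import Data.Rational.Properties using (pos⇒nonZero)
open import Data.Sum.Base using (_⊎_; inj₁; inj₂)
open import Data.Vec.Base using ([]; _∷_)
open import Function.Bundles using (_↔_; Inverse)
open import Relation.Binary.Construct.Closure.ReflexiveTransitive as Star using (Star; ε; _◅_; _◅◅_)
open import Relation.Binary.Core using (Rel)
open import Relation.Binary.Definitions using (Decidable)
open import Relation.Binary.PropositionalEquality using (_≡_; _≢_; refl)
open import Relation.Nullary using (¬_; Dec; yes; no; ¬?)
open import Relation.Nullary.Decidable using (map′; _×-dec_; _⊎-dec_)
open import Level using (0ℓ)

private
  module _ {n : ℕ} where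

    Pairs : Set
    Pairs = List (Fin n × Fin n)

    Step : Pairs → Rel (Fin n) 0ℓ
    Step ps u v = (u , v) List.∈ ps

    add : ∀ {x y ps u v} →
          Star (Step ps) u v ⊎ (Star (Step ps) u x × Star (Step ps) y v) →
          Star (Step ((x , y) ∷ ps)) u v
    add (inj₁ p)       = Star.map there p
    add (inj₂ (p , r)) = Star.map there p ◅◅ (here refl ◅ Star.map there r)

    split : ∀ {x y ps u v} → Star (Step ((x , y) ∷ ps)) u v →
            Star (Step ps) u v ⊎ (Star (Step ps) u x × Star (Step ps) y v)
    split ε = inj₁ ε
    split (here refl ◅ p) with split p
    ... | inj₁ r       = inj₂ (ε , r)
    ... | inj₂ (_ , r) = inj₂ (ε , r)
    split (there s ◅ p) with split p
    ... | inj₁ r        = inj₁ (s ◅ r)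
    ... | inj₂ (r , r′) = inj₂ (s ◅ r , r′)

    step-star? : ∀ ps → Decidable (Star (Step ps))
    step-star? []             u v with u Fin.≟ v
    ... | yes refl = yes ε
    ... | no  u≢v  = no λ { ε → u≢v refl ; (() ◅ _) }
    step-star? ((x , y) ∷ ps) u v = map′ add split
      (step-star? ps u v ⊎-dec (step-star? ps u x ×-dec step-star? ps y v))

star? : ∀ {n} {R : Rel (Fin n) 0ℓ} → Decidable R → Decidable (Star R)
star? {n} {R} R? u v = map′ (Star.map from) (Star.map to) (step-star? pairs u v)
  where
  all-pairs = cartesianProduct (allFin n) (allFin n)

  pairs : List (Fin n × Fin n)
  pairs = filter (λ p → R? (proj₁ p) (proj₂ p)) all-pairs

  from : ∀ {x y} → (x , y) List.∈ pairs → R x y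
  from x∈ = proj₂ (∈-filter⁻ (λ p → R? (proj₁ p) (proj₂ p)) {xs = all-pairs} x∈)

  to : ∀ {x y} → R x y → (x , y) List.∈ pairs
  to {x} {y} r = ∈-filter⁺ (λ p → R? (proj₁ p) (proj₂ p))
    (∈-cartesianProduct⁺ (∈-allFin x) (∈-allFin y)) r

record Graph : Set where
  field
    #V   : ℕ
    #E   : ℕ
    ends : Fin #E → Fin #V × Fin #V

  Vertex Edge : Set
  Vertex = Fin #V
  Edge   = Fin #E

  size : ℕ
  size = #V + #E

  -- A dart is an edge with one of its two orientations; a loop also has
  -- two darts.
  Dart : Set
  Dart = Edge × Bool

  rev : Dart → Dart
  rev (e , b) = e , not b

  tail : Dart → Vertex
  tail (e , false) = proj₁ (ends e)
  tail (e , true)  = proj₂ (ends e)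

  head : Dart → Vertex
  head d = tail (rev d)

  Adjacent : Subset #E → Rel Vertex 0ℓ
  Adjacent A u v = ∃ λ e → e ∈ A × ∃ λ b → tail (e , b) ≡ u × head (e , b) ≡ v

  adjacent? : ∀ A → Decidable (Adjacent A)
  adjacent? A u v = Fin.any? λ e → (e ∈? A) ×-dec orientation? e
    where
    orientation? : ∀ e → Dec (∃ λ b → tail (e , b) ≡ u × head (e , b) ≡ v)
    orientation? e = map′
      (λ { (inj₁ p) → false , p ; (inj₂ p) → true , p })
      (λ { (false , p) → inj₁ p ; (true , p) → inj₂ p })
      (((tail (e , false) Fin.≟ u) ×-dec (head (e , false) Fin.≟ v))
        ⊎-dec
       ((tail (e , true) Fin.≟ u) ×-dec (head (e , true) Fin.≟ v)))

  Connected : Subset #E → Rel Vertex 0ℓ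
  Connected A = Star (Adjacent A)

  connected? : ∀ A → Decidable (Connected A)
  connected? A = star? (adjacent? A)

  -- The number of components of (V , A): deduplication keeps one vertex
  -- of each.
  κ : Subset #E → ℕ
  κ A = length (deduplicate (connected? A) (allFin #V))

  Isolated : Vertex → Set
  Isolated v = ∀ d → tail d ≢ v

-- Plane embeddings, as combinatorial maps
--
-- An embedding is given by the clockwise cyclic order of the darts around
-- each vertex together with the face to the left of each dart.  The
-- faces of a disconnected plane graph may be bounded by several facial
-- walks, and an isolated vertex lies inside a face without being the tail
-- of any dart; hence faces are labels on the facial walks (the orbits of
-- d ↦ rotation (rev d)) and on the isolated vertices.
--
-- faces-connected and euler say that the surface is a sphere.  Write k for the
-- number of components, f for the number of faces and g for the sum of
-- the genera of the components' rotation systems.  There are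
-- 2k - 2g - #V + #E facial walks (an isolated vertex counting as one).
-- They are the edges of a bipartite graph between components and faces,
-- which is connected by faces-connected, so there are at least k + f - 1
-- of them.  Together with euler this forces g = 0 and makes the bipartite
-- graph a tree, which is exactly how the components of a plane graph lie
-- in each other's faces.

record PlaneEmbedding (G : Graph) : Set where
  open Graph G
  field
    rotation        : Dart ↔ Dart
    rotation-tail   : ∀ d → tail (Inverse.to rotation d) ≡ tail d
    rotation-cyclic : ∀ d d′ → tail d ≡ tail d′ →
                      ∃ λ k → iterate (Inverse.to rotation) d k ≡ d′

    #F              : ℕ
    leftFace        : Dart → Fin #F
    leftFace-walk   : ∀ d → leftFace (Inverse.to rotation (rev d)) ≡ leftFace d
    -- Only the values at isolated vertices matter.
    faceAround      : Vertex → Fin #F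

  OnFace : Vertex → Fin #F → Set
  OnFace v F = (∃ λ d → tail d ≡ v × leftFace d ≡ F)
             ⊎ (Isolated v × faceAround v ≡ F)

  ShareVertex : Rel (Fin #F) 0ℓ
  ShareVertex F F′ = ∃ λ v → OnFace v F × OnFace v F′

  field
    faces-connected : ∀ F F′ → Star ShareVertex F F′
    euler           : #V + #F ≡ suc (#E + κ ⊤)

    -- Any face of a map on the sphere can be taken as the unbounded one.
    outerFace       : Fin #F

record TwoTerminalPlanarGraph : Set where
  field
    graph     : Graph
    embedding : PlaneEmbedding graph
  open Graph graph public
  open PlaneEmbedding embedding public
  field
    s t     : Vertex
    s≢t     : s ≢ t
    s-outer : OnFace s outerFace
    t-outer : OnFace t outerFace

subsets : ∀ m → List (Subset m)
subsets zero    = [ [] ]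
subsets (suc m) = map (outside ∷_) (subsets m) ++ map (inside ∷_) (subsets m)

sumℚ productℚ : List ℚ → ℚ
sumℚ     = foldr ℚ._+_ 0ℚ
productℚ = foldr ℚ._*_ 1ℚ

_^ℚ_ : ℚ → ℕ → ℚ
_^ℚ_ = _^_ ℚ.+-*-rawSemiring

module _ (q : ℚ) (Υ : TwoTerminalPlanarGraph) where
  open TwoTerminalPlanarGraph Υ

  term : (Edge → ℚ) → Subset #E → ℚ
  term ŵ A = productℚ (map ŵ (filter (_∈? A) (allFin #E))) ℚ.* (q ^ℚ κ A)

  Z-st : (Edge → ℚ) → ℚ
  Z-st ŵ = sumℚ (map (term ŵ) (filter (λ A → connected? A s t) (subsets #E)))

  Z-s∣t : (Edge → ℚ) → ℚ
  Z-s∣t ŵ = sumℚ (map (term ŵ) (filter (λ A → ¬? (connected? A s t)) (subsets #E)))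

  Implements : (Edge → ℚ) → ℚ → Set
  Implements ŵ w* = Σ (ℚ.NonZero (Z-s∣t ŵ)) λ nz →
    w* ≡ ℚ._÷_ (q ℚ.* Z-st ŵ) (Z-s∣t ŵ) {{nz}}

-- Coefficients in increasing degree.  Coefficients in ℕ lose nothing for
-- upper bounds at non-negative arguments.
Polynomial : Set
Polynomial = List ℕ

evaluate : Polynomial → ℕ → ℕ
evaluate p x = foldr (λ a r → a + x * r) 0 p

-- ⌊log₂ ρ⁻¹⌋ for 0 < ρ ≤ 1.  Since ⌊log₂ x⌋ ≤ log₂ x < ⌊log₂ x⌋ + 1, being
-- polynomially bounded in it and in log ρ⁻¹ (to any base) are the same as
-- ρ → 0.
⌊log₂1/_⌋ : (ρ : ℚ) → .{{ℚ.Positive ρ}} → ℕ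
⌊log₂1/ ρ ⌋ = ⌊log₂ ℤ.∣ ℚ.floor (ℚ.1/_ ρ {{pos⇒nonZero ρ}}) ∣ ⌋

{-# OPTIONS --safe #-}

-- Take Υ to be two vertices s, t joined by k parallel edges.  Only A = ∅
-- separates s from t, so Z_{s|t} = q², Z_{st} = q((1 + α₂)^k - 1), and Υ
-- implements β with 1 + β = (1 + α₂)^k.  Since |1 + α₂| < 1, this has
-- absolute value at most ρ for some k linear in log(1/ρ).

module Submission where

open import Defs
open import Data.Bool.Base using (true; false)
open import Data.Fin.Base using (Fin; zero; suc; fromℕ; inject₁)
open import Data.Fin.Induction using (<-weakInduction; >-weakInduction)
open import Data.Fin.Relation.Unary.Top using (view; view-fromℕ; view-inject₁; ‵fromℕ; ‵inject₁)
open import Data.Fin.Subset using (Subset; inside; outside; ⊥; _∈_)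
open import Data.Fin.Subset.Properties using (_∈?_; ∈⊤; ∉⊥; Empty-unique; drop-there)
open import Data.Integer.Base as ℤ using (+_; +[1+_]; +≤+)
import Data.Integer.Properties as ℤ
open import Data.List.Base using ([]; _∷_; [_]; _++_; map; filter; length; tabulate; allFin)
open import Data.List.Properties using (filter-++; filter-accept; filter-reject; filter-none; filter-≐; map-tabulate; map-∘; map-cong; map-++; map-cong-local)
import Data.List.Relation.Unary.All as All
open import Data.List.Relation.Unary.All.Properties using (all-filter; map⁺)
open import Data.Nat.Base as ℕ using (ℕ; zero; suc)
open import Data.Nat.Coprimality using (Coprime)
open import Data.Nat.DivMod using (m≡m%n+[m/n]*n; m%n<n)
open import Data.Nat.GeneralisedArithmetic using (iterate; iterate-is-fold)
open import Data.Nat.Logarithm using (⌊log₂_⌋; ⌊log₂⌋-mono-≤; ⌊log₂[2^n]⌋≡n)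
import Data.Nat.Properties as ℕ
open import Data.Nat.Tactic.RingSolver using (solve-∀)
open import Data.Product.Base using (∃; _×_; _,_)
open import Data.Rational.Base using (ℚ; mkℚ; 0ℚ; 1ℚ; _/_; _+_; _*_; _-_; -_; 1/_; _≤_; _<_; *<*; ∣_∣; Positive; NonZero; toℚᵘ; positive; negative)
open import Data.Rational.Properties
import Data.Rational.Unnormalised.Base as ℚᵘ
import Data.Rational.Unnormalised.Properties as ℚᵘ
open import Data.Rational.Solver using (module +-*-Solver)
open import Data.Sum.Base using (inj₁; inj₂)
open import Data.Vec.Base as Vec using (_∷_; there)
open import Function.Base using (_∘_; case_of_)
open import Function.Bundles using (mk↔ₛ′)
open import Relation.Binary.Construct.Closure.ReflexiveTransitive using (ε; _◅_)
open import Relation.Binary.Definitions using (tri<; tri≈; tri>)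
open import Relation.Binary.PropositionalEquality using (_≡_; _≢_; refl; sym; trans; cong; cong₂; subst; subst₂; module ≡-Reasoning)
open import Relation.Nullary using (¬_; Dec; does; ¬?; contradiction)
open import Relation.Unary using (Pred; Decidable)

-- Cyclic shifts

module _ {n : ℕ} where

  next prev : Fin (suc n) → Fin (suc n)
  next i with view i
  ... | ‵fromℕ     = zero
  ... | ‵inject₁ j = suc j
  prev zero    = fromℕ n
  prev (suc j) = inject₁ j

  next-fromℕ : next (fromℕ n) ≡ zero
  next-fromℕ rewrite view-fromℕ n = refl

  next-inject₁ : ∀ j → next (inject₁ j) ≡ suc j
  next-inject₁ j rewrite view-inject₁ j = refl

  next∘prev : ∀ i → next (prev i) ≡ i
  next∘prev zero    = next-fromℕ
  next∘prev (suc j) = next-inject₁ j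

  prev∘next : ∀ i → prev (next i) ≡ i
  prev∘next i with view i
  ... | ‵fromℕ     = refl
  ... | ‵inject₁ j = refl

module _ {a} {A : Set a} where

  iterate-+ : ∀ (f : A → A) x m n → iterate f x (m ℕ.+ n) ≡ iterate f (iterate f x m) n
  iterate-+ f x zero    n = refl
  iterate-+ f x (suc m) n = iterate-+ f (f x) m n

  iterate-suc : ∀ (f : A → A) x n → iterate f x (suc n) ≡ f (iterate f x n)
  iterate-suc f x n = trans (sym (iterate-is-fold x f (suc n))) (cong f (iterate-is-fold x f n))

  -- `iterate` applies its function to the starting point first, whereas `g` has to undo the last
  -- `f` first; `iterate-suc` moves one application to the outside.
  iterate-inverse : ∀ {f g : A → A} → (∀ x → g (f x) ≡ x) →
                    ∀ n {x y} → iterate f x n ≡ y → iterate g y n ≡ x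
  iterate-inverse         g∘f zero            eq = sym eq
  iterate-inverse {f} {g} g∘f (suc n) {x} {y} eq = begin
    iterate g y (suc n)  ≡⟨ iterate-suc g y n ⟩
    g (iterate g y n)    ≡⟨ cong g (iterate-inverse g∘f n eq) ⟩
    g (f x)              ≡⟨ g∘f x ⟩
    x                    ∎
    where open ≡-Reasoning

module _ {n : ℕ} where

  -- Induction downwards from the last element, which wraps around to `zero` in one step.
  next-to-zero : ∀ (i : Fin (suc n)) → ∃ λ k → iterate next i k ≡ zero
  next-to-zero = >-weakInduction _ (1 , next-fromℕ) λ i (k , eq) →
    suc k , trans (cong (λ j → iterate next j k) (next-inject₁ i)) eq

  prev-to-zero : ∀ (i : Fin (suc n)) → ∃ λ k → iterate prev i k ≡ zero
  prev-to-zero = <-weakInduction _ (0 , refl) λ i (k , eq) → suc k , eq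

  -- Go forward from `i` to `zero`, then follow the `prev`-path from `j` to `zero` backwards.
  next-transitive : ∀ (i j : Fin (suc n)) → ∃ λ k → iterate next i k ≡ j
  next-transitive i j with next-to-zero i | prev-to-zero j
  ... | k , eq | l , eq′ = k ℕ.+ l , (begin
    iterate next i (k ℕ.+ l)           ≡⟨ iterate-+ next i k l ⟩
    iterate next (iterate next i k) l  ≡⟨ cong (λ x → iterate next x l) eq ⟩
    iterate next zero l                ≡⟨ iterate-inverse next∘prev l eq′ ⟩
    j                                  ∎)
    where open ≡-Reasoning

  prev-transitive : ∀ (i j : Fin (suc n)) → ∃ λ k → iterate prev i k ≡ j
  prev-transitive i j with next-transitive j i
  ... | k , eq = k , iterate-inverse prev∘next k eq

-- The graph of parallel edges

module _ (n : ℕ) where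

  -- Having `suc n` edges guarantees at least one, so that the graph is connected and its edges
  -- carry the cyclic shifts.
  parallelEdges : Graph
  parallelEdges = record { #V = 2 ; #E = suc n ; ends = λ _ → zero , suc zero }

  open Graph parallelEdges

  connected⁺ : ∀ {e A} → e ∈ A → Connected A zero (suc zero)
  connected⁺ {e} e∈A = (e , e∈A , false , refl , refl) ◅ ε

  connected-⊥⁻ : ¬ Connected ⊥ zero (suc zero)
  connected-⊥⁻ ((_ , e∈⊥ , _) ◅ _) = ∉⊥ e∈⊥

  disconnected⇒⊥ : ∀ {A} → ¬ Connected A zero (suc zero) → A ≡ ⊥
  disconnected⇒⊥ ¬conn = Empty-unique λ (_ , e∈A) → ¬conn (connected⁺ e∈A)

  -- On two vertices `deduplicate` keeps `zero` and then tests `suc zero` against it, so `κ`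
  -- computes to one plus the length of a filtered singleton.
  κ-connected : ∀ {A} → Connected A zero (suc zero) → κ A ≡ 1
  κ-connected {A} conn =
    cong (suc ∘ length) (filter-reject (¬? ∘ connected? A zero) {xs = []} λ ¬conn → ¬conn conn)

  κ-⊥ : κ ⊥ ≡ 2
  κ-⊥ = cong (suc ∘ length) (filter-accept (¬? ∘ connected? ⊥ zero) {xs = []} connected-⊥⁻)

  private
    -- The darts `(i , false)` start at `s` and the darts `(i , true)` at `t`. In a plane drawing,
    -- the clockwise orders of the parallel edges at the two ends are opposite.
    rotate unrotate : Dart → Dart
    rotate   (i , false) = next i , false
    rotate   (i , true)  = prev i , true
    unrotate (i , false) = prev i , false
    unrotate (i , true)  = next i , true

    rotate∘unrotate : ∀ d → rotate (unrotate d) ≡ d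
    rotate∘unrotate (i , false) = cong (_, false) (next∘prev i)
    rotate∘unrotate (i , true)  = cong (_, true) (prev∘next i)

    unrotate∘rotate : ∀ d → unrotate (rotate d) ≡ d
    unrotate∘rotate (i , false) = cong (_, false) (prev∘next i)
    unrotate∘rotate (i , true)  = cong (_, true) (next∘prev i)

    rotate-tail : ∀ d → tail (rotate d) ≡ tail d
    rotate-tail (i , false) = refl
    rotate-tail (i , true)  = refl

    iterate-rotate-false : ∀ i k → iterate rotate (i , false) k ≡ (iterate next i k , false)
    iterate-rotate-false i zero    = refl
    iterate-rotate-false i (suc k) = iterate-rotate-false (next i) k

    iterate-rotate-true : ∀ i k → iterate rotate (i , true) k ≡ (iterate prev i k , true)
    iterate-rotate-true i zero    = refl
    iterate-rotate-true i (suc k) = iterate-rotate-true (prev i) k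

    rotate-cyclic : ∀ d d′ → tail d ≡ tail d′ → ∃ λ k → iterate rotate d k ≡ d′
    rotate-cyclic (i , false) (j , false) _ with next-transitive i j
    ... | k , eq = k , trans (iterate-rotate-false i k) (cong (_, false) eq)
    rotate-cyclic (i , true)  (j , true)  _ with prev-transitive i j
    ... | k , eq = k , trans (iterate-rotate-true i k) (cong (_, true) eq)

    -- Face i lies between the edges prev i and i.
    left : Dart → Fin (suc n)
    left (i , false) = i
    left (i , true)  = next i

    left-walk : ∀ d → left (rotate (rev d)) ≡ left d
    left-walk (i , false) = next∘prev i
    left-walk (i , true)  = refl

  parallelEdges-embedding : PlaneEmbedding parallelEdges
  parallelEdges-embedding = record
    { rotation        = mk↔ₛ′ rotate unrotate rotate∘unrotate unrotate∘rotate
    ; rotation-tail   = rotate-tail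
    ; rotation-cyclic = rotate-cyclic
    ; #F              = suc n
    ; leftFace        = left
    ; leftFace-walk   = left-walk
    -- A default value: neither vertex is isolated.
    ; faceAround      = λ _ → zero
    -- Each face `F` lies to the left of the dart `(F , false)`, so all faces meet at `s`.
    ; faces-connected = λ F F′ →
        (zero , inj₁ ((F , false) , refl , refl) , inj₁ ((F′ , false) , refl , refl)) ◅ ε
    -- There are as many faces as edges, and `2` vertices match `1 + κ ⊤`.
    ; euler           = cong suc (trans (ℕ.+-comm 1 (suc n))
        (cong (suc n ℕ.+_) (sym (κ-connected (connected⁺ {zero} ∈⊤)))))
    ; outerFace       = zero
    }

  parallel : TwoTerminalPlanarGraph
  parallel = record
    { graph     = parallelEdges
    ; embedding = parallelEdges-embedding
    ; s         = zero
    ; t         = suc zero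
    ; s≢t       = λ ()
    ; s-outer   = inj₁ ((zero , false) , refl , refl)
    -- At `t` the face label is shifted by `next`, so the outer face `zero` belongs to the last
    -- edge.
    ; t-outer   = inj₁ ((prev zero , true) , refl , next∘prev zero)
    }

-- Sums over subsets

module _ {a} {A : Set a} where

  filter-map : ∀ {b p} {B : Set b} {P : Pred B p} (P? : Decidable P) (f : A → B) xs →
               filter P? (map f xs) ≡ map f (filter (P? ∘ f) xs)
  filter-map P? f []       = refl
  filter-map P? f (x ∷ xs) with does (P? (f x))
  ... | true  = cong (f x ∷_) (filter-map P? f xs)
  ... | false = filter-map P? f xs

  sumℚ-*ʳ : ∀ (f : A → ℚ) c xs → sumℚ (map (λ x → f x * c) xs) ≡ sumℚ (map f xs) * c
  sumℚ-*ʳ f c []       = sym (*-zeroˡ c)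
  sumℚ-*ʳ f c (x ∷ xs) = trans (cong (λ y → f x * c + y) (sumℚ-*ʳ f c xs)) (sym (*-distribʳ-+ c (f x) _))

  sumℚ-partition : ∀ {p} {P : Pred A p} (P? : Decidable P) (f : A → ℚ) xs →
    sumℚ (map f xs) ≡ sumℚ (map f (filter P? xs)) + sumℚ (map f (filter (¬? ∘ P?) xs))
  sumℚ-partition P? f []       = refl
  sumℚ-partition P? f (x ∷ xs) with ih ← sumℚ-partition P? f xs | does (P? x)
  ... | true  = trans (cong (λ y → f x + y) ih) (sym (+-assoc (f x) _ _))
  ... | false = trans (cong (λ y → f x + y) ih)
    (solve 3 (λ x y z → x :+ (y :+ z) := y :+ (x :+ z)) refl (f x) (sumℚ (map f (filter P? xs))) _)
    where open +-*-Solver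

sumℚ-++ : ∀ xs ys → sumℚ (xs ++ ys) ≡ sumℚ xs + sumℚ ys
sumℚ-++ []       ys = sym (+-identityˡ _)
sumℚ-++ (x ∷ xs) ys = trans (cong (λ y → x + y) (sumℚ-++ xs ys)) (sym (+-assoc x _ _))

-- The sums run over lists, so `⊥` must be seen to occur exactly once. The subsets containing the
-- first element are all filtered out; the others are handled by induction.
filter-singleton-⊥ : ∀ {p m} {P : Pred (Subset m) p} (P? : Decidable P) →
                     P ⊥ → (∀ {A} → P A → A ≡ ⊥) → filter P? (subsets m) ≡ [ ⊥ ]
filter-singleton-⊥ {m = zero}  P? P⊥ P⇒⊥ = filter-accept P? P⊥
filter-singleton-⊥ {m = suc m} P? P⊥ P⇒⊥ = begin
  filter P? (map (outside ∷_) (subsets m) ++ map (inside ∷_) (subsets m))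
    ≡⟨ filter-++ P? (map (outside ∷_) (subsets m)) _ ⟩
  filter P? (map (outside ∷_) (subsets m)) ++ filter P? (map (inside ∷_) (subsets m))
    ≡⟨ cong₂ _++_ (filter-map P? _ (subsets m))
         (filter-none P? (map⁺ (All.universal (λ A PA → case P⇒⊥ PA of λ ()) (subsets m)))) ⟩
  map (outside ∷_) (filter (P? ∘ (outside ∷_)) (subsets m)) ++ []
    ≡⟨ cong (λ xs → map (outside ∷_) xs ++ [])
         (filter-singleton-⊥ (P? ∘ (outside ∷_)) P⊥ λ PA → cong Vec.tail (P⇒⊥ PA)) ⟩
  [ ⊥ ] ∎
  where open ≡-Reasoning

-- The factor of `term` that does not involve `q`.
weight : ∀ {m} → (Fin m → ℚ) → Subset m → ℚ
weight {m} ŵ A = productℚ (map ŵ (filter (_∈? A) (allFin m)))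

weight-⊥ : ∀ {m} (ŵ : Fin m → ℚ) → weight ŵ ⊥ ≡ 1ℚ
weight-⊥ {m} ŵ = cong (productℚ ∘ map ŵ)
  (filter-none (_∈? ⊥) (All.universal (λ _ → ∉⊥) (allFin m)))

module _ {m} (ŵ : Fin (suc m) → ℚ) (A : Subset m) where

  private
    -- `allFin (suc m)` computes to `zero ∷ tabulate suc`; this treats what remains once membership
    -- of `zero` is decided.
    weight-tail : ∀ b → productℚ (map ŵ (filter (_∈? (b ∷ A)) (tabulate suc))) ≡ weight (ŵ ∘ suc) A
    weight-tail b = cong productℚ (begin
      map ŵ (filter (_∈? (b ∷ A)) (tabulate suc))
        ≡⟨ cong (map ŵ ∘ filter (_∈? (b ∷ A))) (map-tabulate (λ i → i) suc) ⟨
      map ŵ (filter (_∈? (b ∷ A)) (map suc (allFin m)))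
        ≡⟨ cong (map ŵ) (filter-map (_∈? (b ∷ A)) suc (allFin m)) ⟩
      map ŵ (map suc (filter (λ i → suc i ∈? (b ∷ A)) (allFin m)))
        ≡⟨ cong (map ŵ ∘ map suc) (filter-≐ _ (_∈? A) (drop-there , there) (allFin m)) ⟩
      map ŵ (map suc (filter (_∈? A) (allFin m)))
        ≡⟨ map-∘ (filter (_∈? A) (allFin m)) ⟨
      map (ŵ ∘ suc) (filter (_∈? A) (allFin m)) ∎)
      where open ≡-Reasoning

  weight-outside : weight ŵ (outside ∷ A) ≡ weight (ŵ ∘ suc) A
  weight-outside = weight-tail outside

  weight-inside : weight ŵ (inside ∷ A) ≡ weight (ŵ ∘ suc) A * ŵ zero
  weight-inside = trans (cong (ŵ zero *_) (weight-tail inside)) (*-comm (ŵ zero) _)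

-- Expanding the product chooses `1ℚ` or `ŵ e` for each `e`, one choice per subset. In the
-- induction, the subsets avoiding the first element sum to `S`, the others to `S * ŵ zero`.
sum-weights : ∀ m (ŵ : Fin m → ℚ) →
  sumℚ (map (weight ŵ) (subsets m)) ≡ productℚ (tabulate (λ e → 1ℚ + ŵ e))
sum-weights zero    ŵ = refl
sum-weights (suc m) ŵ = begin
  sumℚ (map (weight ŵ) (map (outside ∷_) (subsets m) ++ map (inside ∷_) (subsets m)))
    ≡⟨ cong sumℚ (map-++ (weight ŵ) (map (outside ∷_) (subsets m)) _) ⟩
  sumℚ (map (weight ŵ) (map (outside ∷_) (subsets m)) ++ map (weight ŵ) (map (inside ∷_) (subsets m)))
    ≡⟨ sumℚ-++ (map (weight ŵ) (map (outside ∷_) (subsets m))) _ ⟩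
  sumℚ (map (weight ŵ) (map (outside ∷_) (subsets m))) + sumℚ (map (weight ŵ) (map (inside ∷_) (subsets m)))
    ≡⟨ cong₂ _+_ (cong sumℚ (map-∘ (subsets m))) (cong sumℚ (map-∘ (subsets m))) ⟨
  sumℚ (map (weight ŵ ∘ (outside ∷_)) (subsets m)) + sumℚ (map (weight ŵ ∘ (inside ∷_)) (subsets m))
    ≡⟨ cong₂ _+_ (cong sumℚ (map-cong (weight-outside ŵ) (subsets m)))
         (trans (cong sumℚ (map-cong (weight-inside ŵ) (subsets m))) (sumℚ-*ʳ _ (ŵ zero) (subsets m))) ⟩
  S + S * ŵ zero
    ≡⟨ solve 2 (λ S w → S :+ S :* w := (con 1ℚ :+ w) :* S) refl S (ŵ zero) ⟩
  (1ℚ + ŵ zero) * S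
    ≡⟨ cong ((1ℚ + ŵ zero) *_) (sum-weights m (ŵ ∘ suc)) ⟩
  (1ℚ + ŵ zero) * productℚ (tabulate (λ e → 1ℚ + ŵ (suc e))) ∎
  where
  open ≡-Reasoning
  open +-*-Solver
  S = sumℚ (map (weight (ŵ ∘ suc)) (subsets m))

productℚ-const : ∀ x m → productℚ (tabulate {n = m} (λ _ → x)) ≡ x ^ℚ m
productℚ-const x zero    = refl
productℚ-const x (suc m) = cong (x *_) (productℚ-const x m)

-- Partition functions of parallel edges

module _ (q : ℚ) (n : ℕ) (ŵ : Fin (suc n) → ℚ) where

  open Graph (parallelEdges n)

  private
    st? : ∀ A → Dec (Connected A zero (suc zero))
    st? A = connected? A zero (suc zero)

    separating : filter (¬? ∘ st?) (subsets (suc n)) ≡ [ ⊥ ]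
    separating = filter-singleton-⊥ (¬? ∘ st?) (connected-⊥⁻ n) (disconnected⇒⊥ n)

  Z-s∣t-parallel : Z-s∣t q (parallel n) ŵ ≡ q * q
  Z-s∣t-parallel = begin
    sumℚ (map (term q (parallel n) ŵ) (filter (¬? ∘ st?) (subsets (suc n))))
      ≡⟨ cong (sumℚ ∘ map (term q (parallel n) ŵ)) separating ⟩
    weight ŵ ⊥ * q ^ℚ κ ⊥ + 0ℚ
      ≡⟨ cong₂ (λ w k → w * q ^ℚ k + 0ℚ) (weight-⊥ ŵ) (κ-⊥ n) ⟩
    1ℚ * (q * (q * 1ℚ)) + 0ℚ
      ≡⟨ solve 1 (λ q → con 1ℚ :* (q :* (q :* con 1ℚ)) :+ con 0ℚ := q :* q) refl q ⟩
    q * q ∎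
    where
    open ≡-Reasoning
    open +-*-Solver

  -- A connecting set leaves one component, hence a single factor `q`. The weights of these sets add
  -- up to the sum over all subsets minus that of `⊥`, which is `1ℚ`.
  Z-st-parallel : Z-st q (parallel n) ŵ ≡ (productℚ (tabulate (λ e → 1ℚ + ŵ e)) - 1ℚ) * q
  Z-st-parallel = begin
    sumℚ (map (term q (parallel n) ŵ) (filter st? (subsets (suc n))))
      ≡⟨ cong sumℚ (map-cong-local (All.map (λ {A} conn → cong (λ k → weight ŵ A * q ^ℚ k) (κ-connected n conn))
           (all-filter st? (subsets (suc n))))) ⟩
    sumℚ (map (λ A → weight ŵ A * (q * 1ℚ)) (filter st? (subsets (suc n))))
      ≡⟨ sumℚ-*ʳ (weight ŵ) (q * 1ℚ) (filter st? (subsets (suc n))) ⟩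
    W * (q * 1ℚ)
      ≡⟨ solve 2 (λ W q → W :* (q :* con 1ℚ) := (W :+ (con 1ℚ :+ con 0ℚ) :- con 1ℚ) :* q) refl W q ⟩
    (W + (1ℚ + 0ℚ) - 1ℚ) * q
      -- The inserted `1ℚ` is read as the total weight of the separating sets, which completes `W`
      -- to the sum over all subsets.
      ≡⟨ cong (λ x → (W + (x + 0ℚ) - 1ℚ) * q) (weight-⊥ ŵ) ⟨
    (W + sumℚ (map (weight ŵ) [ ⊥ ]) - 1ℚ) * q
      ≡⟨ cong (λ x → (W + sumℚ (map (weight ŵ) x) - 1ℚ) * q) separating ⟨
    (W + sumℚ (map (weight ŵ) (filter (¬? ∘ st?) (subsets (suc n)))) - 1ℚ) * q
      ≡⟨ cong (λ x → (x - 1ℚ) * q) (sumℚ-partition st? (weight ŵ) (subsets (suc n))) ⟨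
    (sumℚ (map (weight ŵ) (subsets (suc n))) - 1ℚ) * q
      ≡⟨ cong (λ x → (x - 1ℚ) * q) (sum-weights (suc n) ŵ) ⟩
    (productℚ (tabulate (λ e → 1ℚ + ŵ e)) - 1ℚ) * q ∎
    where
    open ≡-Reasoning
    open +-*-Solver
    W = sumℚ (map (weight ŵ) (filter st? (subsets (suc n))))

  parallel-implements : NonZero (q * q) →
    Implements q (parallel n) ŵ (productℚ (tabulate (λ e → 1ℚ + ŵ e)) - 1ℚ)
  parallel-implements q²≢0 = Z≢0 , sym (begin
    (q * Z-st q (parallel n) ŵ) * 1/Z  ≡⟨ cong (λ z → (q * z) * 1/Z) Z-st-parallel ⟩
    (q * (β * q)) * 1/Z                ≡⟨ solve 3 (λ q β z → (q :* (β :* q)) :* z := β :* ((q :* q) :* z)) refl q β 1/Z ⟩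
    β * ((q * q) * 1/Z)                ≡⟨ cong (λ z → β * (z * 1/Z)) Z-s∣t-parallel ⟨
    β * (Z * 1/Z)                      ≡⟨ cong (β *_) (*-inverseʳ Z {{Z≢0}}) ⟩
    β * 1ℚ                             ≡⟨ *-identityʳ β ⟩
    β                                  ∎)
    where
    open ≡-Reasoning
    open +-*-Solver
    β = productℚ (tabulate (λ e → 1ℚ + ŵ e)) - 1ℚ
    Z = Z-s∣t q (parallel n) ŵ
    Z≢0 : NonZero Z
    Z≢0 = subst NonZero (sym Z-s∣t-parallel) q²≢0
    1/Z = 1/_ Z {{Z≢0}}

-- Powers

module _ where
  open import Data.Nat.Base using (_^_)
  open ℕ.≤-Reasoning

  -- Bernoulli's inequality 1 + n / a ≤ (1 + 1 / a) ^ n, cleared of denominators.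
  bernoulli : ∀ a n → (a ℕ.+ n) ℕ.* a ^ n ℕ.≤ a ℕ.* suc a ^ n
  bernoulli a zero    = ℕ.≤-reflexive (cong (ℕ._* 1) (ℕ.+-identityʳ a))
  bernoulli a (suc n) = begin
    (a ℕ.+ suc n) ℕ.* (a ℕ.* a ^ n)    ≡⟨ ℕ.*-assoc (a ℕ.+ suc n) a (a ^ n) ⟨
    (a ℕ.+ suc n) ℕ.* a ℕ.* a ^ n      ≤⟨ ℕ.*-monoˡ-≤ (a ^ n) lemma ⟩
    suc a ℕ.* (a ℕ.+ n) ℕ.* a ^ n      ≡⟨ ℕ.*-assoc (suc a) (a ℕ.+ n) (a ^ n) ⟩
    suc a ℕ.* ((a ℕ.+ n) ℕ.* a ^ n)    ≤⟨ ℕ.*-monoʳ-≤ (suc a) (bernoulli a n) ⟩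
    suc a ℕ.* (a ℕ.* suc a ^ n)        ≡⟨ ℕ.*-assoc (suc a) a (suc a ^ n) ⟨
    suc a ℕ.* a ℕ.* suc a ^ n          ≡⟨ cong (ℕ._* suc a ^ n) (ℕ.*-comm (suc a) a) ⟩
    a ℕ.* suc a ℕ.* suc a ^ n          ≡⟨ ℕ.*-assoc a (suc a) (suc a ^ n) ⟩
    a ℕ.* (suc a ℕ.* suc a ^ n)        ∎
    where
    lemma : (a ℕ.+ suc n) ℕ.* a ℕ.≤ suc a ℕ.* (a ℕ.+ n)
    lemma = begin
      (a ℕ.+ suc n) ℕ.* a            ≡⟨ cong (ℕ._* a) (ℕ.+-suc a n) ⟩
      a ℕ.+ (a ℕ.+ n) ℕ.* a          ≤⟨ ℕ.+-monoˡ-≤ _ (ℕ.m≤m+n a n) ⟩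
      (a ℕ.+ n) ℕ.+ (a ℕ.+ n) ℕ.* a  ≡⟨ cong ((a ℕ.+ n) ℕ.+_) (ℕ.*-comm (a ℕ.+ n) a) ⟩
      suc a ℕ.* (a ℕ.+ n)            ∎

  -- Bernoulli's inequality with `n = a`: the power `suc a` of the fraction `a / b` is at most one
  -- half. The exponent `a` would fail for `a = 0`, and the extra factor avoids cancelling `a`.
  2a^[1+a]≤b^[1+a] : ∀ {a b} → a ℕ.< b → 2 ℕ.* a ^ suc a ℕ.≤ b ^ suc a
  2a^[1+a]≤b^[1+a] {a} {b} a<b = begin
    2 ℕ.* (a ℕ.* a ^ a)      ≡⟨ ℕ.*-assoc 2 a (a ^ a) ⟨
    2 ℕ.* a ℕ.* a ^ a        ≡⟨ cong (λ x → (a ℕ.+ x) ℕ.* a ^ a) (ℕ.+-identityʳ a) ⟩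
    (a ℕ.+ a) ℕ.* a ^ a      ≤⟨ bernoulli a a ⟩
    a ℕ.* suc a ^ a          ≤⟨ ℕ.*-monoˡ-≤ (suc a ^ a) (ℕ.n≤1+n a) ⟩
    suc a ^ suc a            ≤⟨ ℕ.^-monoˡ-≤ (suc a) a<b ⟩
    b ^ suc a                ∎

  ^-mono-2* : ∀ {x y} n → 2 ℕ.* x ℕ.≤ y → 2 ^ n ℕ.* x ^ n ℕ.≤ y ^ n
  ^-mono-2* zero            2x≤y = ℕ.≤-refl
  ^-mono-2* {x} {y} (suc n) 2x≤y = begin
    (2 ℕ.* 2 ^ n) ℕ.* (x ℕ.* x ^ n)  ≡⟨ ℕ.[m*n]*[o*p]≡[m*o]*[n*p] 2 (2 ^ n) x (x ^ n) ⟩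
    (2 ℕ.* x) ℕ.* (2 ^ n ℕ.* x ^ n)  ≤⟨ ℕ.*-mono-≤ 2x≤y (^-mono-2* n 2x≤y) ⟩
    y ℕ.* y ^ n                      ∎

  -- In fractions: if `c` factors `a / b` at least halve, then `c * l` of them give at most
  -- `1 / 2 ^ l`, which is at most `r / d`.
  ^-*-bound : ∀ {a b d r} c l → 2 ℕ.* a ^ c ℕ.≤ b ^ c → d ℕ.≤ 2 ^ l ℕ.* r →
              a ^ (c ℕ.* l) ℕ.* d ℕ.≤ r ℕ.* b ^ (c ℕ.* l)
  ^-*-bound {a} {b} {d} {r} c l 2a^c≤b^c d≤2^l*r = begin
    a ^ (c ℕ.* l) ℕ.* d                ≡⟨ cong (ℕ._* d) (ℕ.^-*-assoc a c l) ⟨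
    x ℕ.* d                            ≤⟨ ℕ.*-monoʳ-≤ x d≤2^l*r ⟩
    x ℕ.* (2 ^ l ℕ.* r)                ≡⟨ ℕ.*-assoc x (2 ^ l) r ⟨
    x ℕ.* 2 ^ l ℕ.* r                  ≡⟨ ℕ.*-comm (x ℕ.* 2 ^ l) r ⟩
    r ℕ.* (x ℕ.* 2 ^ l)                ≡⟨ cong (r ℕ.*_) (ℕ.*-comm x (2 ^ l)) ⟩
    r ℕ.* (2 ^ l ℕ.* x)                ≤⟨ ℕ.*-monoʳ-≤ r (^-mono-2* {a ^ c} l 2a^c≤b^c) ⟩
    r ℕ.* (b ^ c) ^ l                  ≡⟨ cong (r ℕ.*_) (ℕ.^-*-assoc b c l) ⟩
    r ℕ.* b ^ (c ℕ.* l)                ∎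
    where x = (a ^ c) ^ l

  -- Otherwise monotonicity of the logarithm would put `suc ⌊log₂ n ⌋` below `⌊log₂ n ⌋`.
  n<2^[1+⌊log₂n⌋] : ∀ n → n ℕ.< 2 ^ suc ⌊log₂ n ⌋
  n<2^[1+⌊log₂n⌋] n = ℕ.≰⇒> λ 2^≤n →
    ℕ.1+n≰n (subst (ℕ._≤ ⌊log₂ n ⌋) (⌊log₂[2^n]⌋≡n (suc ⌊log₂ n ⌋)) (⌊log₂⌋-mono-≤ 2^≤n))

  m<2^[1+⌊log₂m/n⌋]*n : ∀ m n .{{_ : ℕ.NonZero n}} → m ℕ.< 2 ^ suc ⌊log₂ (m ℕ./ n) ⌋ ℕ.* n
  m<2^[1+⌊log₂m/n⌋]*n m n = begin-strict
    m                                   ≡⟨ m≡m%n+[m/n]*n m n ⟩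
    m ℕ.% n ℕ.+ (m ℕ./ n) ℕ.* n         <⟨ ℕ.+-monoˡ-< _ (m%n<n m n) ⟩
    suc (m ℕ./ n) ℕ.* n                 ≤⟨ ℕ.*-monoˡ-≤ n (n<2^[1+⌊log₂n⌋] (m ℕ./ n)) ⟩
    2 ^ suc ⌊log₂ (m ℕ./ n) ⌋ ℕ.* n     ∎

-- Transfer to rational numbers

pos-*-/ : ∀ a b x y .{{_ : ℕ.NonZero b}} .{{_ : ℕ.NonZero y}} →
          let instance _ = ℕ.m*n≢0 b y in
          (+ a ℚᵘ./ b) ℚᵘ.* (+ x ℚᵘ./ y) ≡ + (a ℕ.* x) ℚᵘ./ (b ℕ.* y)
pos-*-/ a (suc b) x (suc y) = cong (λ i → ℚᵘ.mkℚᵘ i _) (sym (ℤ.pos-* a x))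

-- Unnormalised fractions keep the powers of numerator and denominator visible, where `ℚ` would
-- reduce to lowest terms.
toℚᵘ-^ : ∀ a d .(c : Coprime a (suc d)) n →
         toℚᵘ (mkℚ (+ a) d c ^ℚ n) ℚᵘ.≃ ℚᵘ._/_ (+ (a ℕ.^ n)) (suc d ℕ.^ n) {{ℕ.m^n≢0 (suc d) n}}
toℚᵘ-^ a d c zero    = ℚᵘ.≃-refl
toℚᵘ-^ a d c (suc n) = ℚᵘ.≃-trans (toℚᵘ-homo-* p (p ^ℚ n))
  (ℚᵘ.≃-trans (ℚᵘ.*-congˡ {toℚᵘ p} (toℚᵘ-^ a d c n))
    (ℚᵘ.≃-reflexive (pos-*-/ a (suc d) (a ℕ.^ n) (suc d ℕ.^ n) {{_}} {{ℕ.m^n≢0 (suc d) n}})))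
  where p = mkℚ (+ a) d c

pos-/-mono : ∀ a b x y .{{_ : ℕ.NonZero b}} .{{_ : ℕ.NonZero y}} →
             a ℕ.* y ℕ.≤ x ℕ.* b → + a ℚᵘ./ b ℚᵘ.≤ + x ℚᵘ./ y
pos-/-mono a (suc b) x (suc y) le = ℚᵘ.*≤*
  (subst₂ ℤ._≤_ (ℤ.pos-* a (suc y)) (ℤ.pos-* x (suc b)) (+≤+ le))

^-abs : ∀ p n → ∣ p ^ℚ n ∣ ≡ ∣ p ∣ ^ℚ n
^-abs p zero    = refl
^-abs p (suc n) = trans (∣p*q∣≡∣p∣*∣q∣ p (p ^ℚ n)) (cong (∣ p ∣ *_) (^-abs p n))

-1<p<1⇒∣p∣<1 : ∀ {p} → - 1ℚ < p → p < 1ℚ → ∣ p ∣ < 1ℚ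
-1<p<1⇒∣p∣<1 {p} -1<p p<1 with ∣p∣≡p∨∣p∣≡-p p
... | inj₁ ∣p∣≡p  = subst (_< 1ℚ) (sym ∣p∣≡p) p<1
... | inj₂ ∣p∣≡-p = subst (_< 1ℚ) (sym ∣p∣≡-p) (neg-antimono-< -1<p)

⌊log₂1/⌋-bound : ∀ r d .(c : Coprime (suc r) (suc d)) → suc d ℕ.≤ 2 ℕ.^ suc ⌊log₂1/ mkℚ +[1+ r ] d c ⌋ ℕ.* suc r
⌊log₂1/⌋-bound r d c = subst (λ m → suc d ℕ.≤ 2 ℕ.^ suc ⌊log₂ m ⌋ ℕ.* suc r)
  -- The floor of `1/ ρ` unfolds to the natural quotient times `+ 1`, the sign of the denominator.
  (cong ℤ.∣_∣ (sym (ℤ.*-identityˡ (+ (suc d ℕ./ suc r)))))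
  (ℕ.<⇒≤ (m<2^[1+⌊log₂m/n⌋]*n (suc d) (suc r)))

-- Take for `c` the numerator of `∣ p ∣`: every `suc c` factors at least halve the power, and
-- `suc ⌊log₂1/ ρ ⌋` halvings bring it to `ρ` or below. The choice of `c` precedes that of `ρ`.
power-small : ∀ {p} → ∣ p ∣ < 1ℚ → ∃ λ c → ∀ ρ .{{_ : Positive ρ}} →
              ∣ p ^ℚ (suc c ℕ.* suc ⌊log₂1/ ρ ⌋) ∣ ≤ ρ
-- Nonnegativity is abstracted along to exclude a negative numerator.
power-small {p} ∣p∣<1 with ∣ p ∣ | ^-abs p | ∣-∣-nonNeg p
power-small {p} (*<* a*1<1*b) | mkℚ (+ a) b′ cop | abs-^ | _ = a , bound
  where
  b = suc b′
  c = suc a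

  a<b : a ℕ.< b
  a<b = ℤ.drop‿+<+ (subst₂ ℤ._<_ (ℤ.*-identityʳ (+ a)) (ℤ.*-identityˡ (+ b)) a*1<1*b)

  bound : ∀ ρ .{{_ : Positive ρ}} → ∣ p ^ℚ (c ℕ.* suc ⌊log₂1/ ρ ⌋) ∣ ≤ ρ
  bound ρ@(mkℚ +[1+ r ] d cop′) = subst (_≤ ρ) (sym (abs-^ k))
    (toℚᵘ-cancel-≤ (ℚᵘ.≤-respˡ-≃ (ℚᵘ.≃-sym (toℚᵘ-^ a b′ cop k))
      (pos-/-mono (a ℕ.^ k) (b ℕ.^ k) (suc r) (suc d) {{ℕ.m^n≢0 b k}}
        (^-*-bound {a} {b} c l (2a^[1+a]≤b^[1+a] a<b) (⌊log₂1/⌋-bound r d cop′)))))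
    where
    l = suc ⌊log₂1/ ρ ⌋
    k = c ℕ.* l

p≢0⇒p*p-nonZero : ∀ {p} → p ≢ 0ℚ → NonZero (p * p)
p≢0⇒p*p-nonZero {p} p≢0 with <-cmp p 0ℚ
... | tri< p<0 _ _ = pos⇒nonZero (p * p) {{neg*neg⇒pos p {{negative p<0}} p {{negative p<0}}}}
... | tri≈ _ p≡0 _ = contradiction p≡0 p≢0
... | tri> _ _ p>0 = pos⇒nonZero (p * p) {{pos*pos⇒pos p {{positive p>0}} p {{positive p>0}}}}

lemma3 : (q α₂ : ℚ) → ¬ (0ℚ ≤ q × q ≤ + 5 / 1) → - (+ 2 / 1) < α₂ → α₂ < 0ℚ →
    ∃ λ (ρ₀ : ℚ) → Positive ρ₀ × ∃ λ (p : Polynomial) →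
    (ρ : ℚ) .{{_ : Positive ρ}} → ρ ≤ ρ₀ →
    ∃ λ (Υ : TwoTerminalPlanarGraph) →
    let open TwoTerminalPlanarGraph Υ in
    ∃ λ (ŵ : Edge → ℚ) → (∀ e → ŵ e ≡ α₂) ×
    ∃ λ (β : ℚ) → Implements q Υ ŵ β
    × ∣ 1ℚ + β ∣ ≤ ρ
    × size ℕ.≤ evaluate p ⌊log₂1/ ρ ⌋
lemma3 q α₂ q∉[0,5] -2<α₂ α₂<0 =
  let c , small = power-small (-1<p<1⇒∣p∣<1 (+-monoʳ-< 1ℚ -2<α₂) (+-monoʳ-< 1ℚ α₂<0))
  -- Two vertices and `suc c * suc l` edges make the size linear in `l`, with coefficients depending
  -- on `α₂` only.
  in 1ℚ , _ , (2 ℕ.+ suc c) ∷ suc c ∷ [] , λ ρ _ →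
    let l = ⌊log₂1/ ρ ⌋
        -- Chosen so that the number of edges `suc n` is `suc c * suc l` by computation.
        n = l ℕ.+ c ℕ.* suc l
    in parallel n , (λ _ → α₂) , (λ _ → refl) , _ ,
       parallel-implements q n (λ _ → α₂) (p≢0⇒p*p-nonZero q≢0) ,
       subst (λ x → ∣ x ∣ ≤ ρ) (sym (trans (1+[x-1]≡x _) (productℚ-const (1ℚ + α₂) (suc n)))) (small ρ) ,
       ℕ.≤-reflexive (cong (2 ℕ.+_) (size-eq c l))
  where
  q≢0 : q ≢ 0ℚ
  -- Zero lies in the excluded interval.
  q≢0 refl = q∉[0,5] (≤-refl , <⇒≤ (positive⁻¹ (+ 5 / 1)))

  1+[x-1]≡x : ∀ x → 1ℚ + (x - 1ℚ) ≡ x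
  1+[x-1]≡x = solve 1 (λ x → con 1ℚ :+ (x :- con 1ℚ) := x) refl
    where open +-*-Solver

  size-eq : ∀ c l → suc c ℕ.* suc l ≡ suc c ℕ.+ l ℕ.* (suc c ℕ.+ l ℕ.* 0)
  size-eq = solve-∀
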